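{- Let $\boldsymbol{\tau} \colon \mathsf{BPT} \to \mathbb K$ be a weighted troupe. For $n \geq 1$, let \[\omega_n = \sum_{T \in \mathsf{Branch}_n} \boldsymbol{\tau}(T)\quad\text{and}\quad\check{\omega}_n = \sum_{T \in \mathsf{BPT}_n} \boldsymbol{\tau}(T).\] Then, the generating functions \[\mathscr{B}(t) = \sum_{n \geq 1} \omega_n t^n\quad\text{and}\quad \mathscr T(t) = \sum_{n \geq 1} \check{\omega}_n t^n\] satisfy \[\mathscr T(t) = \mathscr B\left(\frac{t}{1 - t\mathscr T(t)}\right).\]
   Context: $\mathbb K$ is a commutative ring. $\mathsf{BPT}$ is the set of binary plane trees (rooted trees where each child is designated left or right, each vertex having at most one left and one right child), including the empty tree $\varnothing$; $\mathsf{BPT}_n$ is the set of those with $n$ vertices. A branch is a nonempty binary plane tree in which every vertex has at most one child; $\mathsf{Branch}_n$ is the set of branches with $n$ vertices. For nonempty binary plane trees $T_1,T_2$ and a vertex $v$ of $T_1$, the insertion $\nabla_v(T_1,T_2)$ is obtained by extending $v$ into a left edge (identifying $v$ with the bottom vertex and calling the new upper vertex $v^*$) and attaching $T_2$ as the right subtree of $v^*$. A weighted troupe is a function $\boldsymbol{\tau}\colon\mathsf{BPT}\to\mathbb K$ with $\boldsymbol{\tau}(\varnothing)=0$ and $\boldsymbol{\tau}(\nabla_v(T_1,T_2))=\boldsymbol{\tau}(T_1)\boldsymbol{\tau}(T_2)$ for all $T_1,T_2$ and all vertices $v\in T_1$ (here with a single color, i.e. trees are uncolored). -}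

module Defs where

open import Level using (Level; _⊔_)
open import Algebra.Bundles using (CommutativeRing)
open import Data.Fin.Base using (Fin; toℕ)
import Data.Fin.Base as Fin
open import Data.List.Base using (List; []; _∷_; foldr; filter; cartesianProductWith)
open import Data.List.Membership.Propositional using (_∈_)
open import Data.List.Membership.Propositional.Properties
  using (∈-filter⁺; ∈-filter⁻; ∈-cartesianProductWith⁺; ∈-cartesianProductWith⁻)
open import Data.List.Relation.Unary.All as All using (All)
open import Data.List.Relation.Unary.AllPairs using ([]; _∷_)
open import Data.List.Relation.Unary.Any using (here; there)
open import Data.List.Relation.Unary.Unique.Propositional using (Unique)
open import Data.List.Relation.Unary.Unique.Propositional.Properties
  using (cartesianProductWith⁺; filter⁺)
open import Data.Nat.Base as ℕ using (ℕ; zero; suc; _∸_)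
import Data.Nat.Properties as ℕ
open import Data.Product.Base using (_×_; _,_)
open import Data.Sum.Base using (_⊎_; inj₁; inj₂)
open import Data.Tree.Binary using (Tree; leaf; node; #nodes)
open import Data.Unit.Base using (⊤; tt)
open import Data.Vec.Base using (Vec; []; _∷_; lookup)
open import Function.Base using (_∘_)
open import Function.Bundles using (_⇔_; mk⇔)
open import Relation.Binary.PropositionalEquality using (_≡_; _≢_; refl; sym)
open import Relation.Nullary.Decidable using (Dec; yes; no; ¬?; _×-dec_; _⊎-dec_; map′)

------------------------------------------------------------------------
-- Binary plane trees

-- The vertices of a binary plane tree are the internal nodes; a leaf of
-- the library's `Tree` stands for an absent child (or the empty tree).

BPT : Set
BPT = Tree ⊤ ⊤

pattern ∅       = leaf tt
pattern bin l r = node l tt r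

data Vertex : BPT → Set where
  root  : ∀ {l r} → Vertex (bin l r)
  left  : ∀ {l r} → Vertex l → Vertex (bin l r)
  right : ∀ {l r} → Vertex r → Vertex (bin l r)

-- ∇ T₁ v T₂ is the insertion ∇_v(T₁, T₂).  The new vertex v* takes the
-- place of v; its left subtree is the old subtree rooted at v.

∇ : (T₁ : BPT) → Vertex T₁ → BPT → BPT
∇ (bin l r) root      T₂ = bin (bin l r) T₂
∇ (bin l r) (left v)  T₂ = bin (∇ l v T₂) r
∇ (bin l r) (right v) T₂ = bin l (∇ r v T₂)

AtMostOneChild : ∀ {T} → Vertex T → Set
AtMostOneChild (root {l} {r}) = l ≡ ∅ ⊎ r ≡ ∅
AtMostOneChild (left v)       = AtMostOneChild v
AtMostOneChild (right v)      = AtMostOneChild v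

IsBranch : BPT → Set
IsBranch T = T ≢ ∅ × ((v : Vertex T) → AtMostOneChild v)

empty? : (T : BPT) → Dec (T ≡ ∅)
empty? ∅         = yes refl
empty? (bin _ _) = no λ ()

allAtMostOneChild? : (T : BPT) → Dec ((v : Vertex T) → AtMostOneChild v)
allAtMostOneChild? ∅         = yes λ ()
allAtMostOneChild? (bin l r) = map′
  (λ where
    (p , _ , _) root      → p
    (_ , q , _) (left v)  → q v
    (_ , _ , s) (right v) → s v)
  (λ h → h root , h ∘ left , h ∘ right)
  ((empty? l ⊎-dec empty? r) ×-dec
   (allAtMostOneChild? l ×-dec allAtMostOneChild? r))

isBranch? : (T : BPT) → Dec (IsBranch T)
isBranch? T = ¬? (empty? T) ×-dec allAtMostOneChild? T

------------------------------------------------------------------------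
-- Enumerations of BPTₙ and Branchₙ

-- All trees whose root-to-leaf paths have at most h vertices.

treesOfHeight≤ : ℕ → List BPT
treesOfHeight≤ zero    = ∅ ∷ []
treesOfHeight≤ (suc h) =
  ∅ ∷ cartesianProductWith (λ l r → bin l r) (treesOfHeight≤ h) (treesOfHeight≤ h)

-- A tree with n vertices has height at most n, so nothing is missed.

trees : ℕ → List BPT
trees n = filter (λ T → #nodes T ℕ.≟ n) (treesOfHeight≤ n)

branches : ℕ → List BPT
branches n = filter isBranch? (trees n)

treesOfHeight≤-complete : ∀ h T → #nodes T ℕ.≤ h → T ∈ treesOfHeight≤ h
treesOfHeight≤-complete zero    ∅         _ = here refl
treesOfHeight≤-complete (suc h) ∅         _ = here refl
treesOfHeight≤-complete zero    (bin l r) p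
  rewrite ℕ.+-suc (#nodes l) (#nodes r) with () ← p
treesOfHeight≤-complete (suc h) (bin l r) p
  rewrite ℕ.+-suc (#nodes l) (#nodes r) =
  there (∈-cartesianProductWith⁺ (λ l r → bin l r)
    (treesOfHeight≤-complete h l (ℕ.m+n≤o⇒m≤o (#nodes l) (ℕ.≤-pred p)))
    (treesOfHeight≤-complete h r (ℕ.m+n≤o⇒n≤o (#nodes l) (ℕ.≤-pred p))))

treesOfHeight≤-unique : ∀ h → Unique (treesOfHeight≤ h)
treesOfHeight≤-unique zero    = All.[] ∷ []
treesOfHeight≤-unique (suc h) =
  All.tabulate (λ T∈ → ∅∉ T∈) ∷
  cartesianProductWith⁺ (λ l r → bin l r) (λ { refl → refl , refl })
    (treesOfHeight≤-unique h) (treesOfHeight≤-unique h)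
  where
  ∅∉ : ∀ {T} → T ∈ cartesianProductWith (λ l r → bin l r)
                     (treesOfHeight≤ h) (treesOfHeight≤ h) → ∅ ≢ T
  ∅∉ T∈ refl with ∈-cartesianProductWith⁻ (λ l r → bin l r)
                    (treesOfHeight≤ h) (treesOfHeight≤ h) T∈
  ... | _ , _ , _ , _ , ()

∈-trees : ∀ n {T} → T ∈ trees n ⇔ #nodes T ≡ n
∈-trees n {T} = mk⇔ to from
  where
  to : T ∈ trees n → #nodes T ≡ n
  to T∈ with _ , eq ← ∈-filter⁻ (λ T → #nodes T ℕ.≟ n) {xs = treesOfHeight≤ n} T∈ = eq

  from : #nodes T ≡ n → T ∈ trees n
  from eq = ∈-filter⁺ (λ T → #nodes T ℕ.≟ n)
    (treesOfHeight≤-complete n T (ℕ.≤-reflexive eq)) eq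

trees-unique : ∀ n → Unique (trees n)
trees-unique n = filter⁺ (λ T → #nodes T ℕ.≟ n) (treesOfHeight≤-unique n)

∈-branches : ∀ n {T} → T ∈ branches n ⇔ (#nodes T ≡ n × IsBranch T)
∈-branches n {T} = mk⇔ to from
  where
  open import Function.Bundles using (module Equivalence)

  to : T ∈ branches n → #nodes T ≡ n × IsBranch T
  to T∈ with T∈′ , b ← ∈-filter⁻ isBranch? {xs = trees n} T∈ =
    Equivalence.to (∈-trees n) T∈′ , b

  from : #nodes T ≡ n × IsBranch T → T ∈ branches n
  from (eq , b) = ∈-filter⁺ isBranch? (Equivalence.from (∈-trees n) eq) b

branches-unique : ∀ n → Unique (branches n)
branches-unique n = filter⁺ isBranch? (trees-unique n)

------------------------------------------------------------------------
-- Formal power series over a commutative ring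

module PowerSeries {c ℓ : Level} (𝕂 : CommutativeRing c ℓ) where

  open CommutativeRing 𝕂 renaming (refl to ≈-refl; sym to ≈-sym; trans to ≈-trans)
  open import Algebra.Properties.Semiring.Sum semiring
    using (sum; sum⁺-syntax; sum-syntax; sum-cong-≋; sum-replicate-zero)
  open import Relation.Binary.Reasoning.Setoid setoid

  Series : Set c
  Series = ℕ → Carrier

  infix  4 _≋_
  infixl 6 _⊖_
  infixl 7 _⊛_

  _≋_ : Series → Series → Set ℓ
  f ≋ g = ∀ n → f n ≈ g n

  𝟙 : Series
  𝟙 zero    = 1#
  𝟙 (suc _) = 0#

  t : Series
  t (suc zero) = 1#
  t _          = 0#

  _⊖_ : Series → Series → Series
  (f ⊖ g) n = f n - g n

  _⊛_ : Series → Series → Series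
  (f ⊛ g) n = ∑[ i ≤ n ] (f (toℕ i) * g (n ∸ toℕ i))

  power : Series → ℕ → Series
  power f zero    = 𝟙
  power f (suc k) = f ⊛ power f k

  -- f ⟨ g ⟩ is the substitution f(g(t)), meaningful when g 0 ≈ 0#: then
  -- gᵏ has no tⁿ term for k > n (`power-vanishes`), so the coefficient of
  -- tⁿ in Σₖ fₖ gᵏ is the finite sum below.

  _⟨_⟩ : Series → Series → Series
  (f ⟨ g ⟩) n = ∑[ k ≤ n ] (f (toℕ k) * power g (toℕ k) n)

  -- recip f is 1 / f, meaningful when f 0 ≈ 1#.  Its coefficients satisfy
  -- u₀ = 1 and uₙ₊₁ = - (f₁ uₙ + f₂ uₙ₋₁ + ⋯ + fₙ₊₁ u₀);
  -- recipCoeffs f n is the vector uₙ₋₁ , … , u₀.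

  nextCoeff : Series → ∀ {n} → Vec Carrier n → Carrier
  nextCoeff f {zero}  _  = 1#
  nextCoeff f {suc n} us = - ∑[ i < suc n ] (f (suc (toℕ i)) * lookup us i)

  recipCoeffs : Series → ∀ n → Vec Carrier n
  recipCoeffs f zero    = []
  recipCoeffs f (suc n) = nextCoeff f (recipCoeffs f n) ∷ recipCoeffs f n

  recip : Series → Series
  recip f n = nextCoeff f (recipCoeffs f n)

  power-vanishes : ∀ g → g 0 ≈ 0# → ∀ k n → n ℕ.< k → power g k n ≈ 0#
  power-vanishes g g₀≈0 (suc k) n n<1+k =
    ≈-trans (sum-cong-≋ (λ i → term n n<1+k i)) (sum-replicate-zero (suc n))
    where
    term : ∀ n → n ℕ.< suc k → (i : Fin (suc n)) →
           g (toℕ i) * power g k (n ∸ toℕ i) ≈ 0#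
    term n       _ Fin.zero    = ≈-trans (*-congʳ g₀≈0) (zeroˡ _)
    term (suc n) p (Fin.suc i) =
      ≈-trans (*-congˡ (power-vanishes g g₀≈0 k (n ∸ toℕ i)
                (ℕ.≤-<-trans (ℕ.m∸n≤m n (toℕ i)) (ℕ.≤-pred p))))
              (zeroʳ _)

  lookup-recipCoeffs : ∀ f n (i : Fin (suc n)) →
                       lookup (recipCoeffs f (suc n)) i ≡ recip f (n ∸ toℕ i)
  lookup-recipCoeffs f n       Fin.zero    = refl
  lookup-recipCoeffs f (suc n) (Fin.suc i) = lookup-recipCoeffs f n i

  recip-inverse : ∀ f → f 0 ≈ 1# → f ⊛ recip f ≋ 𝟙
  recip-inverse f f₀≈1 zero    =
    ≈-trans (+-identityʳ _) (≈-trans (*-identityʳ _) f₀≈1)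
  recip-inverse f f₀≈1 (suc n) = begin
    f 0 * recip f (suc n) + ∑[ i ≤ n ] (f (suc (toℕ i)) * recip f (n ∸ toℕ i))
      ≈⟨ +-cong (≈-trans (*-congʳ f₀≈1) (*-identityˡ _))
                (sum-cong-≋ {suc n} λ i → *-congˡ {f (suc (toℕ i))} (reflexive (sym (lookup-recipCoeffs f n i)))) ⟩
    recip f (suc n) + ∑[ i ≤ n ] (f (suc (toℕ i)) * lookup (recipCoeffs f (suc n)) i)
      ≈⟨ -‿inverseˡ _ ⟩
    0# ∎

  -- The side conditions of _⟨_⟩ and recip hold for t / (1 - t h).

  t⊛-constant : ∀ h → (t ⊛ h) 0 ≈ 0#
  t⊛-constant h = ≈-trans (+-identityʳ _) (zeroˡ _)

  𝟙⊖t⊛-constant : ∀ h → (𝟙 ⊖ t ⊛ h) 0 ≈ 1#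
  𝟙⊖t⊛-constant h = begin
    1# - (t ⊛ h) 0  ≈⟨ +-congˡ (-‿cong (t⊛-constant h)) ⟩
    1# - 0#         ≈⟨ +-congʳ (≈-sym (+-identityʳ 1#)) ⟩
    1# + 0# - 0#    ≈⟨ +-assoc _ _ _ ⟩
    1# + (0# - 0#)  ≈⟨ +-congˡ (-‿inverseʳ 0#) ⟩
    1# + 0#         ≈⟨ +-identityʳ 1# ⟩
    1#              ∎

------------------------------------------------------------------------
-- Weighted troupes

module _ {c ℓ : Level} (𝕂 : CommutativeRing c ℓ) where

  open CommutativeRing 𝕂 using (Carrier; _≈_; _+_; _*_; 0#)
  open PowerSeries 𝕂 using (Series)

  -- T₁ is nonempty in `weight-∇` because it has a vertex.

  record WeightedTroupe : Set (c ⊔ ℓ) where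
    field
      weight   : BPT → Carrier
      weight-∅ : weight ∅ ≈ 0#
      weight-∇ : ∀ T₁ T₂ (v : Vertex T₁) → T₂ ≢ ∅ →
                 weight (∇ T₁ v T₂) ≈ weight T₁ * weight T₂

  module GeneratingFunctions (τ : WeightedTroupe) where

    open WeightedTroupe τ

    totalWeight : List BPT → Carrier
    totalWeight = foldr (λ T s → weight T + s) 0#

    ω : ℕ → Carrier
    ω n = totalWeight (branches n)

    ω̌ : ℕ → Carrier
    ω̌ n = totalWeight (trees n)

    𝓑 : Series
    𝓑 zero    = 0#
    𝓑 (suc n) = ω (suc n)

    𝓣 : Series
    𝓣 zero    = 0#
    𝓣 (suc n) = ω̌ (suc n)

{-# OPTIONS --safe #-}

-- At a vertex bin l r with both children present, the weight splits off the
-- factor τ(r) and the vertex disappears, because bin l r is an insertion of r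
-- at the root of l.  This remains true when the tree sits at the bottom of a
-- path of vertices with one child each, that is, for φ = τ ∘ (one-child
-- extensions).  Let F_φ and B_φ be the generating functions of φ over nonempty
-- trees and over branches.  Looking at the root gives, with
-- A_φ = φ(•) + F_{φ ∘ L} + F_{φ ∘ R},
--   F_φ = t (A_φ + F_φ 𝓣),  i.e.  F_φ = X A_φ  for  X = t / (1 - t 𝓣),
--   B_φ = t (φ(•) + B_{φ ∘ L} + B_{φ ∘ R}),
-- and F_φ = B_φ⟨X⟩ follows for all φ at once by induction on the degree.

module Submission where

open import Algebra.Bundles using (CommutativeRing)
open import Data.Empty using (⊥-elim)
open import Data.Fin.Base using (Fin; toℕ; fromℕ<)
open import Data.Fin.Properties using (toℕ-injective; toℕ≤pred[n]; toℕ-fromℕ<)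
open import Data.List.Base using (List; []; _∷_; _++_; map; concat; tabulate; foldr; cartesianProductWith)
open import Data.List.Membership.Propositional using (_∈_; _∉_)
open import Data.List.Membership.Propositional.Properties
open import Data.List.Membership.Propositional.Properties.WithK using (unique∧set⇒bag)
open import Data.List.Relation.Binary.BagAndSetEquality using (∼bag⇒↭)
open import Data.List.Relation.Binary.Disjoint.Propositional using (Disjoint)
open import Data.List.Relation.Binary.Permutation.Propositional using (_↭_; refl; prep; swap; trans)
import Data.List.Relation.Unary.All as All
import Data.List.Relation.Unary.All.Properties as All
import Data.List.Relation.Unary.AllPairs as AllPairs
import Data.List.Relation.Unary.AllPairs.Properties as AllPairs
open import Data.List.Relation.Unary.Any using (here; there)
open import Data.List.Relation.Unary.Unique.Propositional using (Unique)
import Data.List.Relation.Unary.Unique.Propositional.Properties as Unique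
open import Data.Nat.Base as ℕ using (ℕ; zero; suc; _∸_; _≤_; _<_; z≤n; s≤s)
import Data.Nat.Properties as ℕ
open import Data.Product.Base using (_×_; _,_; ∃; proj₁; proj₂)
open import Data.Sum.Base using (inj₁; inj₂)
open import Data.Tree.Binary using (#nodes)
open import Function.Base using (_∘_)
open import Function.Bundles using (_⇔_; mk⇔; module Equivalence)
open import Relation.Binary.PropositionalEquality as ≡ using (_≡_; _≢_)
open import Defs

-- Enumerating trees and branches by their root

-- Sums of weights are invariant under permutation, so this reduces each decomposition of an
-- enumeration to a comparison of members and the absence of repetitions.
unique∧⇔⇒↭ : ∀ {a} {A : Set a} {xs ys : List A} → Unique xs → Unique ys →
             (∀ {x} → x ∈ xs ⇔ x ∈ ys) → xs ↭ ys
unique∧⇔⇒↭ xs! ys! eq = ∼bag⇒↭ (unique∧set⇒bag xs! ys! eq)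

-- Differs from `trees` only in size 0, where the empty tree is dropped, in agreement with the
-- constant term 0 of `𝓣`.
nonemptyTrees : ℕ → List BPT
nonemptyTrees zero    = []
nonemptyTrees (suc n) = trees (suc n)

nonemptyTrees-unique : ∀ n → Unique (nonemptyTrees n)
nonemptyTrees-unique zero    = AllPairs.[]
nonemptyTrees-unique (suc n) = trees-unique (suc n)

∈-nonemptyTrees⁻ : ∀ n {T} → T ∈ nonemptyTrees n → #nodes T ≡ n × T ≢ ∅
∈-nonemptyTrees⁻ (suc n) T∈ with eq ← Equivalence.to (∈-trees (suc n)) T∈ =
  eq , λ { ≡.refl → ℕ.0≢1+n eq }

∈-nonemptyTrees⁺ : ∀ n {T} → #nodes T ≡ n → T ≢ ∅ → T ∈ nonemptyTrees n
∈-nonemptyTrees⁺ zero    {∅}       _  T≢∅ = ⊥-elim (T≢∅ ≡.refl)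
∈-nonemptyTrees⁺ zero    {bin l r} eq _
  rewrite ℕ.+-suc (#nodes l) (#nodes r) with () ← eq
∈-nonemptyTrees⁺ (suc n) eq _ = Equivalence.from (∈-trees (suc n)) eq

∅∉nonemptyTrees : ∀ n → ∅ ∉ nonemptyTrees n
∅∉nonemptyTrees n ∅∈ = proj₂ (∈-nonemptyTrees⁻ n ∅∈) ≡.refl

#nodes-bin : (l r : BPT) → #nodes (bin l r) ≡ suc (#nodes l ℕ.+ #nodes r)
#nodes-bin l r = ℕ.+-suc (#nodes l) (#nodes r)

#nodes-bin-∅ : (l : BPT) → #nodes (bin l ∅) ≡ suc (#nodes l)
#nodes-bin-∅ l = ≡.trans (#nodes-bin l ∅) (≡.cong suc (ℕ.+-identityʳ _))

∅∉branches : ∀ n → ∅ ∉ branches n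
∅∉branches n ∅∈ = proj₁ (proj₂ (Equivalence.to (∈-branches n) ∅∈)) ≡.refl

-- Roots with at most one child, and branches

bin-∅ ∅-bin : BPT → BPT
bin-∅ T = bin T ∅
∅-bin T = bin ∅ T

singleVertex : ℕ → List BPT
singleVertex zero    = bin ∅ ∅ ∷ []
singleVertex (suc _) = []

-- The trees with n + 1 vertices whose root has at most one child, when the
-- child subtree of n vertices is drawn from xs.
extensions : ℕ → List BPT → List BPT
extensions n xs = singleVertex n ++ map bin-∅ xs ++ map ∅-bin xs

-- Membership in `extensions n xs` as a view, so that proofs match on the shape of the tree instead
-- of on positions in an append.
data Extension (n : ℕ) (xs : List BPT) : BPT → Set where
  single  : n ≡ 0 → Extension n xs (bin ∅ ∅)
  onLeft  : ∀ {l} → l ∈ xs → Extension n xs (bin l ∅)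
  onRight : ∀ {r} → r ∈ xs → Extension n xs (bin ∅ r)

∈-singleVertex⁻ : ∀ n {T} → T ∈ singleVertex n → n ≡ 0 × T ≡ bin ∅ ∅
∈-singleVertex⁻ zero (here eq) = ≡.refl , eq

∈-extensions⁻ : ∀ n xs {T} → T ∈ extensions n xs → Extension n xs T
∈-extensions⁻ n xs T∈ with ∈-++⁻ (singleVertex n) T∈
... | inj₁ p with eq , ≡.refl ← ∈-singleVertex⁻ n p = single eq
... | inj₂ q with ∈-++⁻ (map bin-∅ xs) q
...   | inj₁ p with _ , l∈ , ≡.refl ← ∈-map⁻ bin-∅ p = onLeft l∈
...   | inj₂ p with _ , r∈ , ≡.refl ← ∈-map⁻ ∅-bin p = onRight r∈

∈-extensions⁺ : ∀ n xs {T} → Extension n xs T → T ∈ extensions n xs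
∈-extensions⁺ n xs (single ≡.refl) = here ≡.refl
∈-extensions⁺ n xs (onLeft l∈)  = ∈-++⁺ʳ (singleVertex n) (∈-++⁺ˡ (∈-map⁺ bin-∅ l∈))
∈-extensions⁺ n xs (onRight r∈) =
  ∈-++⁺ʳ (singleVertex n) (∈-++⁺ʳ (map bin-∅ xs) (∈-map⁺ ∅-bin r∈))

-- If `∅` were in `xs`, the tree `bin ∅ ∅` would arise both as a left and as a right extension.
-- Excluding it makes the three blocks disjoint.
extensions-unique : ∀ n {xs} → ∅ ∉ xs → Unique xs → Unique (extensions n xs)
extensions-unique n {xs} ∅∉xs xs! =
  Unique.++⁺ (single! n)
    (Unique.++⁺ (Unique.map⁺ (λ { ≡.refl → ≡.refl }) xs!)
                (Unique.map⁺ (λ { ≡.refl → ≡.refl }) xs!) left#right)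
    single#rest
  where
  single! : ∀ n → Unique (singleVertex n)
  single! zero    = All.[] AllPairs.∷ AllPairs.[]
  single! (suc _) = AllPairs.[]

  left#right : Disjoint (map bin-∅ xs) (map ∅-bin xs)
  left#right (p , q) with ∈-map⁻ bin-∅ p | ∈-map⁻ ∅-bin q
  ... | _ , l∈ , ≡.refl | _ , _ , ≡.refl = ∅∉xs l∈

  single#rest : Disjoint (singleVertex n) (map bin-∅ xs ++ map ∅-bin xs)
  single#rest (p , q) with _ , ≡.refl ← ∈-singleVertex⁻ n p | ∈-++⁻ (map bin-∅ xs) q
  ... | inj₁ q′ with _ , l∈ , ≡.refl ← ∈-map⁻ bin-∅ q′ = ∅∉xs l∈
  ... | inj₂ q′ with _ , r∈ , ≡.refl ← ∈-map⁻ ∅-bin q′ = ∅∉xs r∈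

-- Removing the root of a branch with more than one vertex leaves a branch, and putting a root with
-- one child below a branch gives a branch again.
branches-↭ : ∀ n → branches (suc n) ↭ extensions n (branches n)
branches-↭ n = unique∧⇔⇒↭ (branches-unique (suc n))
  (extensions-unique n (∅∉branches n) (branches-unique n))
  (mk⇔ (λ T∈ → let eq , b = Equivalence.to (∈-branches (suc n)) T∈ in
               ∈-extensions⁺ n (branches n) (to _ eq b))
       (λ T∈ → Equivalence.from (∈-branches (suc n)) (from (∈-extensions⁻ n (branches n) T∈))))
  where
  to : ∀ T → #nodes T ≡ suc n → IsBranch T → Extension n (branches n) T
  to ∅ eq (T≢∅ , _) = ⊥-elim (T≢∅ ≡.refl)
  to (bin l r) eq (_ , one) with one root
  to (bin ∅ ∅) eq (_ , one) | _ = single (≡.sym (ℕ.suc-injective eq))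
  to (bin l@(bin _ _) ∅) eq (_ , one) | inj₂ ≡.refl =
    onLeft (Equivalence.from (∈-branches n)
      (ℕ.suc-injective (≡.trans (≡.sym (#nodes-bin-∅ l)) eq) , (λ ()) , one ∘ left))
  to (bin ∅ r@(bin _ _)) eq (_ , one) | inj₁ ≡.refl =
    onRight (Equivalence.from (∈-branches n)
      (ℕ.suc-injective eq , (λ ()) , one ∘ right))

  from : ∀ {T} → Extension n (branches n) T → #nodes T ≡ suc n × IsBranch T
  from (single ≡.refl) = ≡.refl , (λ ()) , λ { root → inj₁ ≡.refl }
  from (onLeft {l} l∈) with eq , _ , one ← Equivalence.to (∈-branches n) l∈ =
    ≡.trans (#nodes-bin-∅ l) (≡.cong suc eq) , (λ ()) ,
    λ { root → inj₂ ≡.refl ; (left v) → one v }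
  from (onRight r∈) with eq , _ , one ← Equivalence.to (∈-branches n) r∈ =
    ≡.cong suc eq , (λ ()) , λ { root → inj₁ ≡.refl ; (right v) → one v }

-- Roots with two children, and all trees

pairsOfSize : ∀ n → Fin (suc n) → List BPT
pairsOfSize n i = cartesianProductWith (λ l r → bin l r)
  (nonemptyTrees (toℕ i)) (nonemptyTrees (n ∸ toℕ i))

-- Grouping by the size of the left subtree gives the weight sum the shape of coefficient `n` of a
-- product `⊛`.
twoChildren : ℕ → List BPT
twoChildren n = concat (tabulate (pairsOfSize n))

data BothNonempty : BPT → Set where
  both : ∀ {l r} → l ≢ ∅ → r ≢ ∅ → BothNonempty (bin l r)

∈-pairsOfSize⁻ : ∀ n i {T} → T ∈ pairsOfSize n i →
  ∃ λ l → ∃ λ r → T ≡ bin l r × l ∈ nonemptyTrees (toℕ i) × r ∈ nonemptyTrees (n ∸ toℕ i)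
∈-pairsOfSize⁻ n i T∈
  with l , r , l∈ , r∈ , eq ← ∈-cartesianProductWith⁻ (λ l r → bin l r) _ _ T∈ =
  l , r , eq , l∈ , r∈

∈-twoChildren⁻ : ∀ n {T} → T ∈ twoChildren n → #nodes T ≡ suc n × BothNonempty T
∈-twoChildren⁻ n T∈
  with _ , T∈ys , ys∈ ← ∈-concat⁻′ (tabulate (pairsOfSize n)) T∈
  with i , ≡.refl ← ∈-tabulate⁻ {f = pairsOfSize n} ys∈
  with l , r , ≡.refl , l∈ , r∈ ← ∈-pairsOfSize⁻ n i T∈ys
  with #l , l≢∅ ← ∈-nonemptyTrees⁻ (toℕ i) l∈
  with #r , r≢∅ ← ∈-nonemptyTrees⁻ (n ∸ toℕ i) r∈ =
  ≡.trans (#nodes-bin l r)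
    (≡.cong suc (≡.trans (≡.cong₂ ℕ._+_ #l #r) (ℕ.m+[n∸m]≡n (toℕ≤pred[n] i)))) ,
  both l≢∅ r≢∅

∈-twoChildren⁺ : ∀ n {T} → #nodes T ≡ suc n → BothNonempty T → T ∈ twoChildren n
∈-twoChildren⁺ n eq (both {l} {r} l≢∅ r≢∅) =
  ∈-concat⁺′
    (∈-cartesianProductWith⁺ (λ l r → bin l r)
      (∈-nonemptyTrees⁺ (toℕ i) (≡.sym i≡#l) l≢∅)
      (∈-nonemptyTrees⁺ (n ∸ toℕ i) #r r≢∅))
    (∈-tabulate⁺ {f = pairsOfSize n} i)
  where
  sizes : #nodes l ℕ.+ #nodes r ≡ n
  sizes = ℕ.suc-injective (≡.trans (≡.sym (#nodes-bin l r)) eq)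

  #l<1+n : #nodes l < suc n
  #l<1+n = s≤s (ℕ.m+n≤o⇒m≤o (#nodes l) (ℕ.≤-reflexive sizes))

  i : Fin (suc n)
  i = fromℕ< #l<1+n

  i≡#l : toℕ i ≡ #nodes l
  i≡#l = toℕ-fromℕ< #l<1+n

  #r : #nodes r ≡ n ∸ toℕ i
  #r = ≡.trans (≡.sym (ℕ.m+n∸m≡n (#nodes l) (#nodes r)))
               (≡.cong₂ _∸_ sizes (≡.sym i≡#l))

-- The size of the left subtree determines the index of the block, so distinct blocks are disjoint.
twoChildren-unique : ∀ n → Unique (twoChildren n)
twoChildren-unique n = Unique.concat⁺
  (All.tabulate⁺ λ i → Unique.cartesianProductWith⁺ (λ l r → bin l r)
    (λ { ≡.refl → ≡.refl , ≡.refl })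
    (nonemptyTrees-unique (toℕ i)) (nonemptyTrees-unique (n ∸ toℕ i)))
  (AllPairs.tabulate⁺ λ {i} {j} i≢j → disjoint i j i≢j)
  where
  disjoint : ∀ i j → i ≢ j → Disjoint (pairsOfSize n i) (pairsOfSize n j)
  disjoint i j i≢j (p , q) with ∈-pairsOfSize⁻ n i p | ∈-pairsOfSize⁻ n j q
  ... | _ , _ , ≡.refl , l∈ , _ | _ , _ , ≡.refl , l∈′ , _ =
    i≢j (toℕ-injective (≡.trans (≡.sym (proj₁ (∈-nonemptyTrees⁻ (toℕ i) l∈)))
                                (proj₁ (∈-nonemptyTrees⁻ (toℕ j) l∈′))))

trees-↭ : ∀ n → trees (suc n) ↭ extensions n (nonemptyTrees n) ++ twoChildren n
trees-↭ n = unique∧⇔⇒↭ (trees-unique (suc n))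
  (Unique.++⁺ (extensions-unique n (∅∉nonemptyTrees n) (nonemptyTrees-unique n))
              (twoChildren-unique n) disjoint)
  (mk⇔ (λ T∈ → to _ (Equivalence.to (∈-trees (suc n)) T∈))
       (λ T∈ → Equivalence.from (∈-trees (suc n)) (from T∈)))
  where
  ext⁺ : ∀ {T} → Extension n (nonemptyTrees n) T →
         T ∈ extensions n (nonemptyTrees n) ++ twoChildren n
  ext⁺ e = ∈-++⁺ˡ (∈-extensions⁺ n (nonemptyTrees n) e)

  disjoint : Disjoint (extensions n (nonemptyTrees n)) (twoChildren n)
  disjoint (p , q) with ∈-extensions⁻ n (nonemptyTrees n) p | proj₂ (∈-twoChildren⁻ n q)
  ... | single _  | both l≢∅ _ = l≢∅ ≡.refl
  ... | onLeft _  | both _ r≢∅ = r≢∅ ≡.refl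
  ... | onRight _ | both l≢∅ _ = l≢∅ ≡.refl

  to : ∀ T → #nodes T ≡ suc n → T ∈ extensions n (nonemptyTrees n) ++ twoChildren n
  to (bin ∅ ∅) eq = ext⁺ (single (≡.sym (ℕ.suc-injective eq)))
  to (bin l@(bin _ _) ∅) eq = ext⁺ (onLeft (∈-nonemptyTrees⁺ n
    (ℕ.suc-injective (≡.trans (≡.sym (#nodes-bin-∅ l)) eq)) λ ()))
  to (bin ∅ r@(bin _ _)) eq = ext⁺ (onRight (∈-nonemptyTrees⁺ n (ℕ.suc-injective eq) λ ()))
  to (bin (bin _ _) (bin _ _)) eq =
    ∈-++⁺ʳ (extensions n (nonemptyTrees n)) (∈-twoChildren⁺ n eq (both (λ ()) (λ ())))

  size : ∀ {T} → Extension n (nonemptyTrees n) T → #nodes T ≡ suc n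
  size (single ≡.refl) = ≡.refl
  size (onLeft {l} l∈) = ≡.trans (#nodes-bin-∅ l) (≡.cong suc (proj₁ (∈-nonemptyTrees⁻ n l∈)))
  size (onRight r∈)    = ≡.cong suc (proj₁ (∈-nonemptyTrees⁻ n r∈))

  from : ∀ {T} → T ∈ extensions n (nonemptyTrees n) ++ twoChildren n → #nodes T ≡ suc n
  from T∈ with ∈-++⁻ (extensions n (nonemptyTrees n)) T∈
  ... | inj₁ p = size (∈-extensions⁻ n (nonemptyTrees n) p)
  ... | inj₂ q = proj₁ (∈-twoChildren⁻ n q)

-- The ring of formal power series

module SeriesProperties {c ℓ} (𝕂 : CommutativeRing c ℓ) where

  open CommutativeRing 𝕂 renaming (refl to ≈-refl; sym to ≈-sym; trans to ≈-trans)
  open import Algebra.Properties.CommutativeSemigroup +-commutativeSemigroup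
    using (x∙yz≈y∙xz)
  open import Algebra.Properties.CommutativeSemigroup *-commutativeSemigroup
    using () renaming (x∙yz≈y∙xz to x*yz≈y*xz)
  open import Algebra.Properties.Group +-group using (//-rightDividesʳ)
  open import Algebra.Properties.Ring ring using (-1*x≈-x)
  open import Algebra.Properties.Semiring.Sum semiring
    using (sum; sum⁺-syntax; sum-syntax; sum-cong-≋; sum-replicate-zero; ∑-comm; ∑-distrib-+; *-distribˡ-sum)
  open import Relation.Binary.Reasoning.Setoid setoid
  open PowerSeries 𝕂

  sum-zero : ∀ {n} (f : Fin n → Carrier) → (∀ i → f i ≈ 0#) → sum f ≈ 0#
  sum-zero {n} f f≈0 = ≈-trans (sum-cong-≋ f≈0) (sum-replicate-zero n)

  ⊛-cong : ∀ {f f′ g g′} → f ≋ f′ → g ≋ g′ → f ⊛ g ≋ f′ ⊛ g′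
  ⊛-cong f≋ g≋ n = sum-cong-≋ {suc n} λ i → *-cong (f≋ (toℕ i)) (g≋ (n ∸ toℕ i))

  ⊛-congˡ : ∀ f {g g′} → g ≋ g′ → f ⊛ g ≋ f ⊛ g′
  ⊛-congˡ f = ⊛-cong {f} (λ _ → ≈-refl)

  ⊛-congʳ : ∀ {f f′} g → f ≋ f′ → f ⊛ g ≋ f′ ⊛ g
  ⊛-congʳ g f≋ = ⊛-cong {g = g} f≋ (λ _ → ≈-refl)

  -- The coefficient of degree n of the second factor is only ever multiplied by the vanishing
  -- constant term of `f`. This drop in degree drives the final induction.
  ⊛-cong-< : ∀ f {g g′} n → f 0 ≈ 0# → (∀ j → j < n → g j ≈ g′ j) →
             (f ⊛ g) n ≈ (f ⊛ g′) n
  ⊛-cong-< f {g} {g′} n f₀≈0 g≈ = sum-cong-≋ {suc n} (term n g≈)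
    where
    term : ∀ n → (∀ j → j < n → g j ≈ g′ j) → (i : Fin (suc n)) →
           f (toℕ i) * g (n ∸ toℕ i) ≈ f (toℕ i) * g′ (n ∸ toℕ i)
    term n g≈ Fin.zero =
      ≈-trans (≈-trans (*-congʳ f₀≈0) (zeroˡ _)) (≈-sym (≈-trans (*-congʳ f₀≈0) (zeroˡ _)))
    term (suc n) g≈ (Fin.suc i) = *-congˡ (g≈ _ (s≤s (ℕ.m∸n≤m n (toℕ i))))

  ⊛-distribʳ-+ : ∀ f g h → (λ n → f n + g n) ⊛ h ≋ λ n → (f ⊛ h) n + (g ⊛ h) n
  ⊛-distribʳ-+ f g h n = ≈-trans
    (sum-cong-≋ {suc n} λ i → distribʳ (h (n ∸ toℕ i)) (f (toℕ i)) (g (toℕ i)))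
    (∑-distrib-+ {suc n} (λ i → f (toℕ i) * h (n ∸ toℕ i)) (λ i → g (toℕ i) * h (n ∸ toℕ i)))

  ⊛-scaleˡ : ∀ c f g → (λ n → c * f n) ⊛ g ≋ λ n → c * (f ⊛ g) n
  ⊛-scaleˡ c f g n = ≈-trans
    (sum-cong-≋ {suc n} λ i → *-assoc c (f (toℕ i)) (g (n ∸ toℕ i)))
    (≈-sym (*-distribˡ-sum {suc n} c (λ i → f (toℕ i) * g (n ∸ toℕ i))))

  -- Subtraction is addition of the multiple by -1, so additivity and scaling suffice.
  ⊛-distribʳ-⊖ : ∀ f g h → (f ⊖ g) ⊛ h ≋ (f ⊛ h) ⊖ (g ⊛ h)
  ⊛-distribʳ-⊖ f g h n = begin
    ((f ⊖ g) ⊛ h) n                      ≈⟨ ⊛-congʳ h (λ m → +-congˡ {f m} (-1*x≈-x (g m))) n ⟨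
    ((λ m → f m + - 1# * g m) ⊛ h) n     ≈⟨ ⊛-distribʳ-+ f (λ m → - 1# * g m) h n ⟩
    (f ⊛ h) n + ((λ m → - 1# * g m) ⊛ h) n ≈⟨ +-congˡ (⊛-scaleˡ (- 1#) g h n) ⟩
    (f ⊛ h) n + - 1# * (g ⊛ h) n         ≈⟨ +-congˡ (-1*x≈-x _) ⟩
    (f ⊛ h) n - (g ⊛ h) n                ∎

  -- Induction on the degree replaces the reindexing of a double sum: `(f ⊛ g) (suc n)` computes to
  -- `f 0 * g (suc n)` plus coefficient `n` of `(f ∘ suc) ⊛ g`.
  ⊛-assoc : ∀ f g h → (f ⊛ g) ⊛ h ≋ f ⊛ (g ⊛ h)
  ⊛-assoc f g h zero = begin
    (f 0 * g 0 + 0#) * h 0 + 0#  ≈⟨ +-congʳ (*-congʳ (+-identityʳ _)) ⟩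
    f 0 * g 0 * h 0 + 0#         ≈⟨ +-congʳ (*-assoc _ _ _) ⟩
    f 0 * (g 0 * h 0) + 0#       ≈⟨ +-congʳ (*-congˡ (+-identityʳ _)) ⟨
    f 0 * (g 0 * h 0 + 0#) + 0#  ∎
  ⊛-assoc f g h (suc n) = begin
    (f 0 * g 0 + 0#) * h (suc n) + ((λ m → f 0 * g (suc m) + (f′ ⊛ g) m) ⊛ h) n
      ≈⟨ +-cong (*-congʳ (+-identityʳ _)) (⊛-distribʳ-+ (λ m → f 0 * g′ m) (f′ ⊛ g) h n) ⟩
    f 0 * g 0 * h (suc n) + (((λ m → f 0 * g′ m) ⊛ h) n + ((f′ ⊛ g) ⊛ h) n)
      ≈⟨ +-cong (*-assoc _ _ _) (+-cong (⊛-scaleˡ (f 0) g′ h n) (⊛-assoc f′ g h n)) ⟩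
    f 0 * (g 0 * h (suc n)) + (f 0 * (g′ ⊛ h) n + (f′ ⊛ (g ⊛ h)) n)
      ≈⟨ +-assoc _ _ _ ⟨
    f 0 * (g 0 * h (suc n)) + f 0 * (g′ ⊛ h) n + (f′ ⊛ (g ⊛ h)) n
      ≈⟨ +-congʳ (distribˡ _ _ _) ⟨
    f 0 * (g 0 * h (suc n) + (g′ ⊛ h) n) + (f′ ⊛ (g ⊛ h)) n ∎
    where
    f′ g′ : Series
    f′ = f ∘ suc
    g′ = g ∘ suc

  -- The definition splits off the first term of the sum; splitting off the last one instead gives
  -- the mirror recursion from which commutativity follows.
  ⊛-unfoldʳ : ∀ f g n → (f ⊛ g) (suc n) ≈ f (suc n) * g 0 + (f ⊛ (g ∘ suc)) n
  ⊛-unfoldʳ f g zero    = x∙yz≈y∙xz _ _ _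
  ⊛-unfoldʳ f g (suc n) = ≈-trans (+-congˡ (⊛-unfoldʳ (f ∘ suc) g n)) (x∙yz≈y∙xz _ _ _)

  ⊛-comm : ∀ f g → f ⊛ g ≋ g ⊛ f
  ⊛-comm f g zero    = +-congʳ (*-comm _ _)
  ⊛-comm f g (suc n) = ≈-trans (+-cong (*-comm _ _) (⊛-comm (f ∘ suc) g n))
                               (≈-sym (⊛-unfoldʳ g f n))

  ⊛-identityˡ : ∀ f → 𝟙 ⊛ f ≋ f
  ⊛-identityˡ f n = begin
    (𝟙 ⊛ f) n    ≈⟨ +-cong (*-identityˡ _) (sum-zero {n} _ λ i → zeroˡ _) ⟩
    f n + 0#     ≈⟨ +-identityʳ _ ⟩
    f n          ∎

  t⊛-suc : ∀ f n → (t ⊛ f) (suc n) ≈ f n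
  t⊛-suc f n = begin
    0# * f (suc n) + ((t ∘ suc) ⊛ f) n  ≈⟨ +-cong (zeroˡ _) (⊛-congʳ f t-suc n) ⟩
    0# + (𝟙 ⊛ f) n                      ≈⟨ +-identityˡ _ ⟩
    (𝟙 ⊛ f) n                           ≈⟨ ⊛-identityˡ f n ⟩
    f n                                 ∎
    where
    t-suc : t ∘ suc ≋ 𝟙
    t-suc zero    = ≈-refl
    t-suc (suc _) = ≈-refl

  -- Multiplication by `f` is linear. This is what takes a common factor out of a finite combination
  -- of powers.
  ∑-⊛ : ∀ {m} (a : Fin m → Carrier) f (g : Fin m → Series) n →
        ∑[ k < m ] (a k * (f ⊛ g k) n) ≈ (f ⊛ λ j → ∑[ k < m ] (a k * g k j)) n
  ∑-⊛ {m} a f g n = begin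
    ∑[ k < m ] (a k * ∑[ i ≤ n ] (f (toℕ i) * g k (n ∸ toℕ i)))
      ≈⟨ sum-cong-≋ {m} (λ k → ≈-trans (*-distribˡ-sum {suc n} (a k) (λ i → f (toℕ i) * g k (n ∸ toℕ i)))
           (sum-cong-≋ {suc n} λ i → x*yz≈y*xz (a k) (f (toℕ i)) (g k (n ∸ toℕ i)))) ⟩
    ∑[ k < m ] ∑[ i ≤ n ] (f (toℕ i) * (a k * g k (n ∸ toℕ i)))
      ≈⟨ ∑-comm {m} {suc n} (λ k i → f (toℕ i) * (a k * g k (n ∸ toℕ i))) ⟩
    ∑[ i ≤ n ] ∑[ k < m ] (f (toℕ i) * (a k * g k (n ∸ toℕ i)))
      ≈⟨ sum-cong-≋ {suc n} (λ i → ≈-sym (*-distribˡ-sum {m} (f (toℕ i)) (λ k → a k * g k (n ∸ toℕ i)))) ⟩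
    (f ⊛ λ j → ∑[ k < m ] (a k * g k j)) n ∎

  -- The hypotheses say f = t (a + f h). Hence (1 - t h) f = t a, and it remains to multiply by the
  -- inverse of 1 - t h.
  fixpoint-solution : ∀ a f h → f 0 ≈ 0# →
                      (∀ n → f (suc n) ≈ a n + (f ⊛ h) n) →
                      f ≋ (t ⊛ recip (𝟙 ⊖ t ⊛ h)) ⊛ a
  fixpoint-solution a f h f₀≈0 f-suc n = begin
    f n                ≈⟨ ⊛-identityˡ f n ⟨
    (𝟙 ⊛ f) n          ≈⟨ ⊛-congʳ f (recip-inverse d (𝟙⊖t⊛-constant h)) n ⟨
    ((d ⊛ u) ⊛ f) n    ≈⟨ ⊛-congʳ f (⊛-comm d u) n ⟩
    ((u ⊛ d) ⊛ f) n    ≈⟨ ⊛-assoc u d f n ⟩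
    (u ⊛ (d ⊛ f)) n    ≈⟨ ⊛-congˡ u d⊛f≋t⊛a n ⟩
    (u ⊛ (t ⊛ a)) n    ≈⟨ ⊛-assoc u t a n ⟨
    ((u ⊛ t) ⊛ a) n    ≈⟨ ⊛-congʳ a (⊛-comm u t) n ⟩
    ((t ⊛ u) ⊛ a) n    ∎
    where
    d u : Series
    d = 𝟙 ⊖ t ⊛ h
    u = recip d

    th⊛f : ∀ n → ((t ⊛ h) ⊛ f) n ≈ (t ⊛ (f ⊛ h)) n
    th⊛f n = ≈-trans (⊛-assoc t h f n) (⊛-congˡ t (⊛-comm h f) n)

    f≋ : ∀ n → f n ≈ (t ⊛ a) n + (t ⊛ (f ⊛ h)) n
    f≋ zero = begin
      f 0                            ≈⟨ f₀≈0 ⟩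
      0#                             ≈⟨ +-identityʳ 0# ⟨
      0# + 0#                        ≈⟨ +-cong (t⊛-constant a) (t⊛-constant (f ⊛ h)) ⟨
      (t ⊛ a) 0 + (t ⊛ (f ⊛ h)) 0    ∎
    f≋ (suc n) = ≈-trans (f-suc n) (≈-sym (+-cong (t⊛-suc a n) (t⊛-suc (f ⊛ h) n)))

    d⊛f≋t⊛a : d ⊛ f ≋ t ⊛ a
    d⊛f≋t⊛a n = begin
      (d ⊛ f) n                        ≈⟨ ⊛-distribʳ-⊖ 𝟙 (t ⊛ h) f n ⟩
      (𝟙 ⊛ f) n - ((t ⊛ h) ⊛ f) n      ≈⟨ +-cong (⊛-identityˡ f n) (-‿cong (th⊛f n)) ⟩
      f n - (t ⊛ (f ⊛ h)) n            ≈⟨ +-congʳ (f≋ n) ⟩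
      (t ⊛ a) n + (t ⊛ (f ⊛ h)) n - (t ⊛ (f ⊛ h)) n  ≈⟨ //-rightDividesʳ ((t ⊛ (f ⊛ h)) n) ((t ⊛ a) n) ⟩
      (t ⊛ a) n                        ∎

-- Weights summed over lists

module ListSums {c ℓ} (𝕂 : CommutativeRing c ℓ) where

  open CommutativeRing 𝕂 renaming (refl to ≈-refl; sym to ≈-sym; trans to ≈-trans)
  open import Algebra.Properties.CommutativeSemigroup +-commutativeSemigroup using (x∙yz≈y∙xz)
  open import Algebra.Properties.Semiring.Sum semiring using (sum-syntax)
  open import Relation.Binary.Reasoning.Setoid setoid

  listSum : ∀ {a} {A : Set a} → (A → Carrier) → List A → Carrier
  listSum φ = foldr (λ x s → φ x + s) 0#

  module _ {a} {A : Set a} (φ : A → Carrier) where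

    listSum-↭ : ∀ {xs ys} → xs ↭ ys → listSum φ xs ≈ listSum φ ys
    listSum-↭ refl         = ≈-refl
    listSum-↭ (prep x p)   = +-congˡ (listSum-↭ p)
    listSum-↭ (swap x y p) = ≈-trans (x∙yz≈y∙xz _ _ _) (+-congˡ (+-congˡ (listSum-↭ p)))
    listSum-↭ (trans p q)  = ≈-trans (listSum-↭ p) (listSum-↭ q)

    listSum-++ : ∀ xs ys → listSum φ (xs ++ ys) ≈ listSum φ xs + listSum φ ys
    listSum-++ []       ys = ≈-sym (+-identityˡ _)
    listSum-++ (x ∷ xs) ys = ≈-trans (+-congˡ (listSum-++ xs ys)) (≈-sym (+-assoc _ _ _))

    listSum-map : ∀ {b} {B : Set b} (f : B → A) xs → listSum φ (map f xs) ≈ listSum (φ ∘ f) xs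
    listSum-map f []       = ≈-refl
    listSum-map f (x ∷ xs) = +-congˡ (listSum-map f xs)

    listSum-concat-tabulate : ∀ {n} (f : Fin n → List A) →
      listSum φ (concat (tabulate f)) ≈ ∑[ i < n ] listSum φ (f i)
    listSum-concat-tabulate {zero}  f = ≈-refl
    listSum-concat-tabulate {suc n} f = ≈-trans (listSum-++ (f Fin.zero) _)
      (+-congˡ (listSum-concat-tabulate (f ∘ Fin.suc)))

  listSum-scale : ∀ {a} {A : Set a} (φ ψ : A → Carrier) c xs →
                  (∀ {x} → x ∈ xs → φ x ≈ c * ψ x) → listSum φ xs ≈ c * listSum ψ xs
  listSum-scale φ ψ c []       φ≈ = ≈-sym (zeroʳ c)
  listSum-scale φ ψ c (x ∷ xs) φ≈ = ≈-trans
    (+-cong (φ≈ (here ≡.refl)) (listSum-scale φ ψ c xs (φ≈ ∘ there)))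
    (≈-sym (distribˡ c _ _))

  -- The factorization is demanded only on members of the two lists, because the weights in question
  -- factor only for nonempty subtrees.
  listSum-cartesianProductWith :
    ∀ {a} {A B C : Set a} (f : A → B → C) (φ : C → Carrier) (ψ : A → Carrier) (χ : B → Carrier) xs ys →
    (∀ {x y} → x ∈ xs → y ∈ ys → φ (f x y) ≈ ψ x * χ y) →
    listSum φ (cartesianProductWith f xs ys) ≈ listSum ψ xs * listSum χ ys
  listSum-cartesianProductWith f φ ψ χ []       ys φ≈ = ≈-sym (zeroˡ _)
  listSum-cartesianProductWith f φ ψ χ (x ∷ xs) ys φ≈ = begin
    listSum φ (map (f x) ys ++ cartesianProductWith f xs ys)
      ≈⟨ listSum-++ φ (map (f x) ys) _ ⟩
    listSum φ (map (f x) ys) + listSum φ (cartesianProductWith f xs ys)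
      ≈⟨ +-cong (≈-trans (listSum-map φ (f x) ys)
                         (listSum-scale (φ ∘ f x) χ (ψ x) ys (φ≈ (here ≡.refl))))
                (listSum-cartesianProductWith f φ ψ χ xs ys (φ≈ ∘ there)) ⟩
    ψ x * listSum χ ys + listSum ψ xs * listSum χ ys
      ≈⟨ distribʳ _ _ _ ⟨
    (ψ x + listSum ψ xs) * listSum χ ys ∎

-- Generating functions of contextual weights

module _ {c ℓ} (𝕂 : CommutativeRing c ℓ) (τ : WeightedTroupe 𝕂) where

  open CommutativeRing 𝕂 renaming (refl to ≈-refl; sym to ≈-sym; trans to ≈-trans)
  open import Algebra.Properties.Semiring.Sum semiring
    using (sum⁺-syntax; sum-cong-≋; ∑-distrib-+)
  open import Relation.Binary.Reasoning.Setoid setoid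
  open PowerSeries 𝕂
  open SeriesProperties 𝕂
  open ListSums 𝕂
  open WeightedTroupe τ
  open GeneratingFunctions 𝕂 τ

  -- The second factor is `weight T₂` and not `φ T₂`: an insertion inside a subtree is an insertion
  -- in the whole tree, which splits off the weight of `T₂` alone.
  Contextual : (BPT → Carrier) → Set ℓ
  Contextual φ = ∀ T₁ T₂ (v : Vertex T₁) → T₂ ≢ ∅ → φ (∇ T₁ v T₂) ≈ φ T₁ * weight T₂

  -- Insertion at `left v` computes to insertion at `v` in the left subtree, so the claim is an
  -- instance of the hypothesis. The case of `∅-bin` is symmetric.
  contextual-bin-∅ : ∀ {φ} → Contextual φ → Contextual (φ ∘ bin-∅)
  contextual-bin-∅ φ-∇ T₁ T₂ v = φ-∇ (bin T₁ ∅) T₂ (left v)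

  contextual-∅-bin : ∀ {φ} → Contextual φ → Contextual (φ ∘ ∅-bin)
  contextual-∅-bin φ-∇ T₁ T₂ v = φ-∇ (bin ∅ T₁) T₂ (right v)

  contextual-bin : ∀ {φ} → Contextual φ → ∀ {l r} → l ≢ ∅ → r ≢ ∅ →
                   φ (bin l r) ≈ φ l * weight r
  contextual-bin φ-∇ {∅}           l≢∅ r≢∅ = ⊥-elim (l≢∅ ≡.refl)
  -- Once `l` is known to be a node, `∇ l root r` computes to `bin l r`.
  contextual-bin φ-∇ {l@(bin _ _)} l≢∅ r≢∅ = φ-∇ l _ root r≢∅

  treeSeries branchSeries : (BPT → Carrier) → Series
  treeSeries   φ n = listSum φ (nonemptyTrees n)
  branchSeries φ n = listSum φ (branches n)

  -- Trees and branches share this expression: `G = treeSeries` gives A_φ, and `G = branchSeries`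
  -- gives the series whose product with t is B_φ.
  extensionSeries : ((BPT → Carrier) → Series) → (BPT → Carrier) → Series
  extensionSeries G φ n = φ (bin ∅ ∅) * 𝟙 n + (G (φ ∘ bin-∅) n + G (φ ∘ ∅-bin) n)

  treeSeries-weight : treeSeries weight ≋ 𝓣
  treeSeries-weight zero    = ≈-refl
  treeSeries-weight (suc n) = ≈-refl

  branchSeries-weight : branchSeries weight ≋ 𝓑
  -- The only tree without vertices is empty, hence no branch, and `branches 0` evaluates to `[]`.
  branchSeries-weight zero    = ≈-refl
  branchSeries-weight (suc n) = ≈-refl

  listSum-extensions : ∀ φ n xs → listSum φ (extensions n xs) ≈
    φ (bin ∅ ∅) * 𝟙 n + (listSum (φ ∘ bin-∅) xs + listSum (φ ∘ ∅-bin) xs)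
  listSum-extensions φ n xs = begin
    listSum φ (singleVertex n ++ map bin-∅ xs ++ map ∅-bin xs)
      ≈⟨ listSum-++ φ (singleVertex n) _ ⟩
    listSum φ (singleVertex n) + listSum φ (map bin-∅ xs ++ map ∅-bin xs)
      ≈⟨ +-cong (single-vertex n) (≈-trans (listSum-++ φ (map bin-∅ xs) _)
           (+-cong (listSum-map φ bin-∅ xs) (listSum-map φ ∅-bin xs))) ⟩
    φ (bin ∅ ∅) * 𝟙 n + (listSum (φ ∘ bin-∅) xs + listSum (φ ∘ ∅-bin) xs) ∎
    where
    single-vertex : ∀ n → listSum φ (singleVertex n) ≈ φ (bin ∅ ∅) * 𝟙 n
    single-vertex zero    = ≈-trans (+-identityʳ _) (≈-sym (*-identityʳ _))
    single-vertex (suc _) = ≈-sym (zeroʳ _)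

  branchSeries-suc : ∀ φ n → branchSeries φ (suc n) ≈ extensionSeries branchSeries φ n
  branchSeries-suc φ n = ≈-trans (listSum-↭ φ (branches-↭ n)) (listSum-extensions φ n (branches n))

  -- A root with children `l` and `r` contributes `φ l * weight r`; summed over all sizes this is
  -- the product of F_φ and `𝓣`. All other roots contribute A_φ.
  treeSeries-suc : ∀ {φ} → Contextual φ → ∀ n →
    treeSeries φ (suc n) ≈ extensionSeries treeSeries φ n + (treeSeries φ ⊛ 𝓣) n
  treeSeries-suc {φ} φ-∇ n = begin
    listSum φ (trees (suc n))
      ≈⟨ listSum-↭ φ (trees-↭ n) ⟩
    listSum φ (extensions n (nonemptyTrees n) ++ twoChildren n)
      ≈⟨ listSum-++ φ (extensions n (nonemptyTrees n)) _ ⟩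
    listSum φ (extensions n (nonemptyTrees n)) + listSum φ (twoChildren n)
      ≈⟨ +-cong (listSum-extensions φ n (nonemptyTrees n))
           (≈-trans (listSum-concat-tabulate φ (pairsOfSize n)) (sum-cong-≋ {suc n} pairs)) ⟩
    extensionSeries treeSeries φ n + (treeSeries φ ⊛ treeSeries weight) n
      ≈⟨ +-congˡ (⊛-congˡ (treeSeries φ) treeSeries-weight n) ⟩
    extensionSeries treeSeries φ n + (treeSeries φ ⊛ 𝓣) n ∎
    where
    pairs : ∀ i → listSum φ (pairsOfSize n i) ≈
                  treeSeries φ (toℕ i) * treeSeries weight (n ∸ toℕ i)
    pairs i = listSum-cartesianProductWith (λ l r → bin l r) φ φ weight _ _ λ l∈ r∈ →
      contextual-bin φ-∇ (proj₂ (∈-nonemptyTrees⁻ (toℕ i) l∈))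
                         (proj₂ (∈-nonemptyTrees⁻ (n ∸ toℕ i) r∈))

  -- Substitution of t / (1 - t 𝓣) into the branch series

  X : Series
  X = t ⊛ recip (𝟙 ⊖ t ⊛ 𝓣)

  -- A partial sum of f ⟨ X ⟩: the tⁿ coefficient is already correct for n ≤ N.
  substituteUpTo : ℕ → Series → Series
  substituteUpTo N f n = ∑[ k ≤ N ] (f (toℕ k) * power X (toℕ k) n)

  substituteUpTo-cong : ∀ N {f g} → f ≋ g → substituteUpTo N f ≋ substituteUpTo N g
  substituteUpTo-cong N f≋g n = sum-cong-≋ {suc N} λ k → *-congʳ {power X (toℕ k) n} (f≋g (toℕ k))

  substituteUpTo-+ : ∀ N f g n → substituteUpTo N (λ k → f k + g k) n ≈
                     substituteUpTo N f n + substituteUpTo N g n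
  substituteUpTo-+ N f g n = ≈-trans
    (sum-cong-≋ {suc N} λ k → distribʳ (power X (toℕ k) n) (f (toℕ k)) (g (toℕ k)))
    (∑-distrib-+ {suc N} (λ k → f (toℕ k) * power X (toℕ k) n) (λ k → g (toℕ k) * power X (toℕ k) n))

  substituteUpTo-constant : ∀ N a n → substituteUpTo N (λ k → a * 𝟙 k) n ≈ a * 𝟙 n
  substituteUpTo-constant N a n = begin
    substituteUpTo N (λ k → a * 𝟙 k) n
      ≈⟨ +-cong (*-congʳ (*-identityʳ a))
                (sum-zero {N} _ λ k → ≈-trans (*-congʳ (zeroʳ a)) (zeroˡ _)) ⟩
    a * 𝟙 n + 0#  ≈⟨ +-identityʳ _ ⟩
    a * 𝟙 n       ∎

  -- Without a constant term, every summand contains a factor `X`. A cutoff independent of the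
  -- degree, unlike the one in `_⟨_⟩`, makes this an identity of series.
  substituteUpTo-suc : ∀ N f → f 0 ≈ 0# →
                       substituteUpTo (suc N) f ≋ X ⊛ substituteUpTo N (f ∘ suc)
  substituteUpTo-suc N f f₀≈0 n = begin
    f 0 * 𝟙 n + ∑[ k ≤ N ] (f (suc (toℕ k)) * (X ⊛ power X (toℕ k)) n)
      ≈⟨ +-cong (≈-trans (*-congʳ f₀≈0) (zeroˡ _))
           (∑-⊛ {suc N} (λ k → f (suc (toℕ k))) X (λ k → power X (toℕ k)) n) ⟩
    0# + (X ⊛ substituteUpTo N (f ∘ suc)) n
      ≈⟨ +-identityˡ _ ⟩
    (X ⊛ substituteUpTo N (f ∘ suc)) n ∎

  -- The induction is on the cutoff with φ arbitrary, since the step passes from φ to `φ ∘ bin-∅`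
  -- and `φ ∘ ∅-bin`.
  substitute-branchSeries : ∀ N {φ} → Contextual φ → ∀ n → n ≤ N →
                            substituteUpTo N (branchSeries φ) n ≈ treeSeries φ n
  -- Both sides vanish: `branches 0` and `nonemptyTrees 0` are empty.
  substitute-branchSeries zero    φ-∇ zero z≤n = ≈-trans (+-identityʳ _) (zeroˡ _)
  substitute-branchSeries (suc N) {φ} φ-∇ n n≤1+N = begin
    substituteUpTo (suc N) (branchSeries φ) n
      ≈⟨ substituteUpTo-suc N (branchSeries φ) ≈-refl n ⟩
    (X ⊛ substituteUpTo N (branchSeries φ ∘ suc)) n
      -- As `X` has no constant term, only degrees j < n ≤ N + 1 of the second factor matter, and
      -- there j ≤ N as the induction hypothesis requires.
      ≈⟨ ⊛-cong-< X n (t⊛-constant (recip (𝟙 ⊖ t ⊛ 𝓣)))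
           (λ j j<n → lower j (ℕ.≤-pred (ℕ.≤-trans j<n n≤1+N))) ⟩
    (X ⊛ extensionSeries treeSeries φ) n
      ≈⟨ fixpoint-solution (extensionSeries treeSeries φ) (treeSeries φ) 𝓣 ≈-refl
           (treeSeries-suc φ-∇) n ⟨
    treeSeries φ n ∎
    where
    B₁ B₂ : Series
    B₁ = branchSeries (φ ∘ bin-∅)
    B₂ = branchSeries (φ ∘ ∅-bin)

    lower : ∀ j → j ≤ N →
            substituteUpTo N (branchSeries φ ∘ suc) j ≈ extensionSeries treeSeries φ j
    lower j j≤N = begin
      substituteUpTo N (branchSeries φ ∘ suc) j
        ≈⟨ substituteUpTo-cong N (branchSeries-suc φ) j ⟩
      substituteUpTo N (extensionSeries branchSeries φ) j
        ≈⟨ substituteUpTo-+ N (λ k → φ (bin ∅ ∅) * 𝟙 k) (λ k → B₁ k + B₂ k) j ⟩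
      substituteUpTo N (λ k → φ (bin ∅ ∅) * 𝟙 k) j + substituteUpTo N (λ k → B₁ k + B₂ k) j
        ≈⟨ +-cong (substituteUpTo-constant N (φ (bin ∅ ∅)) j) (≈-trans (substituteUpTo-+ N B₁ B₂ j)
             (+-cong (substitute-branchSeries N (contextual-bin-∅ φ-∇) j j≤N)
                     (substitute-branchSeries N (contextual-∅-bin φ-∇) j j≤N))) ⟩
      extensionSeries treeSeries φ j ∎

  𝓣≋𝓑⟨X⟩ : 𝓣 ≋ 𝓑 ⟨ X ⟩
  𝓣≋𝓑⟨X⟩ n = begin
    𝓣 n                                        ≈⟨ treeSeries-weight n ⟨
    -- The cutoff is taken equal to the degree, which is the truncation used by `_⟨_⟩`.
    treeSeries weight n                        ≈⟨ substitute-branchSeries n weight-∇ n ℕ.≤-refl ⟨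
    substituteUpTo n (branchSeries weight) n   ≈⟨ substituteUpTo-cong n branchSeries-weight n ⟩
    (𝓑 ⟨ X ⟩) n                                ∎

theorem5p1 : ∀ {c ℓ} (𝕂 : CommutativeRing c ℓ) (τ : WeightedTroupe 𝕂) →
    let open PowerSeries 𝕂
        open GeneratingFunctions 𝕂 τ
    in 𝓣 ≋ 𝓑 ⟨ t ⊛ recip (𝟙 ⊖ t ⊛ 𝓣) ⟩
theorem5p1 𝕂 τ = 𝓣≋𝓑⟨X⟩ 𝕂 τ
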